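{- Let $\mathrm{BH}$ be the higher inductive type with a point constructor $\mathrm{pt} : \mathrm{BH}$, four path constructors $a,b,c,d : \Omega\mathrm{BH}$, and four $2$-cell constructors $a = [d,a]$, $b = [a,b]$, $c = [b,c]$, $d = [c,d]$. Then $\mathrm{BH}$ is acyclic.
   Context: We work in homotopy type theory (HoTT) in the style of the HoTT Book: dependent type theory with univalent universes (hence function extensionality) and higher inductive types; no classical axioms are assumed. $\Omega\mathrm{BH}$ denotes the loop type $(\mathrm{pt} =_{\mathrm{BH}} \mathrm{pt})$, with product given by path concatenation, and $[x,y]$ denotes the commutator $xyx^{ -1}y^{ -1}$. ($\mathrm{BH}$ is the presentation complex of Higman's group $\mathrm{H} = \langle a,b,c,d \mid a=[d,a], b=[a,b], c=[b,c], d=[c,d]\rangle$.) The suspension $\Sigma A$ of a type $A$ is the pushout of $\mathbf{1} \leftarrow A \to \mathbf{1}$. A type is acyclic if its suspension is contractible. -}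

{-# OPTIONS --without-K #-}
-- Homotopy type theory is rendered in Agda without axiom K: types are Agda's
-- types, _≡_ is the identity type, and univalence and higher inductive types
-- are hypotheses.  A higher inductive type is a type with the given
-- constructors and its induction principle into families at every universe
-- level.  The computation rules are stated as identities, and together: the
-- section produced from given data has an action on the constructors equal
-- to these data.
module Defs where

open import Agda.Primitive using (Setω)
open import Level using (Level; _⊔_; suc)
open import Data.Product using (Σ; Σ-syntax; _,_; proj₁)
open import Data.Unit using (⊤; tt)
open import Function using (id)
open import Relation.Binary.PropositionalEquality
  using (_≡_; refl; sym; trans; cong; cong₂; subst; dcong)

private
  variable
    i j k ℓ ℓ′ : Level

IsContr : Set ℓ → Set ℓ
IsContr X = Σ[ x ∈ X ] (∀ y → x ≡ y)

IsEquiv : {X : Set ℓ} {Y : Set ℓ′} → (X → Y) → Set (ℓ ⊔ ℓ′)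
IsEquiv {X = X} f = ∀ y → IsContr (Σ[ x ∈ X ] f x ≡ y)

_≃_ : Set ℓ → Set ℓ′ → Set (ℓ ⊔ ℓ′)
X ≃ Y = Σ[ f ∈ (X → Y) ] IsEquiv f

idEquiv : (X : Set ℓ) → X ≃ X
idEquiv X = id , λ y → (y , refl) , λ { (_ , refl) → refl }

idToEquiv : {X Y : Set ℓ} → X ≡ Y → X ≃ Y
idToEquiv {X = X} refl = idEquiv X

Univalence : (ℓ : Level) → Set (suc ℓ)
Univalence ℓ = (X Y : Set ℓ) → IsEquiv (idToEquiv {X = X} {Y = Y})

infixl 7 _∙_

_∙_ : {X : Set ℓ} {x y z : X} → x ≡ y → y ≡ z → x ≡ z
_∙_ = trans

[_,_] : {X : Set ℓ} {x : X} → x ≡ x → x ≡ x → x ≡ x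
[ p , q ] = p ∙ q ∙ sym p ∙ sym q

PathOver : {X : Set ℓ} (P : X → Set ℓ′) {x y : X} → x ≡ y → P x → P y → Set ℓ′
PathOver P p u v = subst P p u ≡ v

module _ {X : Set ℓ} {P : X → Set ℓ′} where

  infixl 7 _∙ᴰ_

  _∙ᴰ_ : {x y z : X} {p : x ≡ y} {q : y ≡ z} {u : P x} {v : P y} {w : P z} →
         PathOver P p u v → PathOver P q v w → PathOver P (p ∙ q) u w
  _∙ᴰ_ {p = refl} {q = q} α β = cong (subst P q) α ∙ β

  symᴰ : {x y : X} {p : x ≡ y} {u : P x} {v : P y} →
         PathOver P p u v → PathOver P (sym p) v u
  symᴰ {p = refl} α = sym α

  [_,_]ᴰ : {x : X} {p q : x ≡ x} {u : P x} →
           PathOver P p u u → PathOver P q u u → PathOver P [ p , q ] u u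
  [_,_]ᴰ {p = p} {q = q} α β =
    _∙ᴰ_ {p = p ∙ q ∙ sym p} {q = sym q}
      (_∙ᴰ_ {p = p ∙ q} {q = sym p} (_∙ᴰ_ {p = p} {q = q} α β) (symᴰ {p = p} α))
      (symᴰ {p = q} β)

  module _ (f : ∀ x → P x) where

    dcong-∙ : {x y z : X} (p : x ≡ y) (q : y ≡ z) →
              dcong f (p ∙ q) ≡ _∙ᴰ_ {p = p} {q = q} (dcong f p) (dcong f q)
    dcong-∙ refl q = refl

    dcong-sym : {x y : X} (p : x ≡ y) →
                dcong f (sym p) ≡ symᴰ {p = p} (dcong f p)
    dcong-sym refl = refl

    dcong-[,] : {x : X} (p q : x ≡ x) →
                dcong f [ p , q ] ≡ [_,_]ᴰ {p = p} {q = q} (dcong f p) (dcong f q)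
    dcong-[,] p q =
      dcong-∙ (p ∙ q ∙ sym p) (sym q)
      ∙ cong₂ (_∙ᴰ_ {p = p ∙ q ∙ sym p} {q = sym q})
          (dcong-∙ (p ∙ q) (sym p)
           ∙ cong₂ (_∙ᴰ_ {p = p ∙ q} {q = sym p}) (dcong-∙ p q) (dcong-sym p))
          (dcong-sym q)

record PushoutDataOver {A : Set i} {B : Set j} {C : Set k} (f : C → A) (g : C → B)
  {X : Set ℓ} (inl : A → X) (inr : B → X) (glue : ∀ z → inl (f z) ≡ inr (g z))
  (P : X → Set ℓ′) : Set (i ⊔ j ⊔ k ⊔ ℓ′) where
  constructor mkPushoutDataOver
  field
    inlᴰ  : ∀ x → P (inl x)
    inrᴰ  : ∀ y → P (inr y)
    glueᴰ : ∀ z → PathOver P (glue z) (inlᴰ (f z)) (inrᴰ (g z))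

record Pushout {A : Set i} {B : Set j} {C : Set k} (f : C → A) (g : C → B) : Setω where
  field
    Carrier : Set (i ⊔ j ⊔ k)
    inl     : A → Carrier
    inr     : B → Carrier
    glue    : ∀ z → inl (f z) ≡ inr (g z)

  restrict : {P : Carrier → Set ℓ} → (∀ x → P x) → PushoutDataOver f g inl inr glue P
  restrict s = mkPushoutDataOver (λ x → s (inl x)) (λ y → s (inr y)) (λ z → dcong s (glue z))

  field
    induction : (P : Carrier → Set ℓ) (D : PushoutDataOver f g inl inr glue P) →
                Σ[ s ∈ (∀ x → P x) ] restrict s ≡ D

record HoTT : Setω where
  field
    univalence : Univalence ℓ
    pushout    : {A : Set i} {B : Set j} {C : Set k} (f : C → A) (g : C → B) → Pushout f g

  Susp : Set ℓ → Set ℓ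
  Susp A = Pushout.Carrier (pushout {C = A} (λ _ → tt) (λ _ → tt))

  Acyclic : Set ℓ → Set ℓ
  Acyclic A = IsContr (Susp A)

record HigmanData (X : Set ℓ) : Set ℓ where
  field
    pt      : X
    a b c d : pt ≡ pt
    rel-a   : a ≡ [ d , a ]
    rel-b   : b ≡ [ a , b ]
    rel-c   : c ≡ [ b , c ]
    rel-d   : d ≡ [ c , d ]

record HigmanDataOver {X : Set ℓ} (K : HigmanData X) (P : X → Set ℓ′) : Set ℓ′ where
  open HigmanData K
  field
    ptᴰ : P pt

  LoopOver : pt ≡ pt → Set ℓ′
  LoopOver p = PathOver P p ptᴰ ptᴰ

  field
    aᴰ     : LoopOver a
    bᴰ     : LoopOver b
    cᴰ     : LoopOver c
    dᴰ     : LoopOver d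
    rel-aᴰ : PathOver LoopOver rel-a aᴰ ([_,_]ᴰ {p = d} {q = a} dᴰ aᴰ)
    rel-bᴰ : PathOver LoopOver rel-b bᴰ ([_,_]ᴰ {p = a} {q = b} aᴰ bᴰ)
    rel-cᴰ : PathOver LoopOver rel-c cᴰ ([_,_]ᴰ {p = b} {q = c} bᴰ cᴰ)
    rel-dᴰ : PathOver LoopOver rel-d dᴰ ([_,_]ᴰ {p = c} {q = d} cᴰ dᴰ)

module _ {X : Set ℓ} (K : HigmanData X) {P : X → Set ℓ′} where
  open HigmanData K

  -- The action of a section on the 2-cells: dcong (dcong s) r ends in
  -- dcong s [ x , y ], which dcong-[,] rewrites as a commutator over [ x , y ].
  restrictHigman : (∀ x → P x) → HigmanDataOver K P
  restrictHigman s = record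
    { ptᴰ    = s pt
    ; aᴰ     = dcong s a
    ; bᴰ     = dcong s b
    ; cᴰ     = dcong s c
    ; dᴰ     = dcong s d
    ; rel-aᴰ = dcong (dcong s) rel-a ∙ dcong-[,] s d a
    ; rel-bᴰ = dcong (dcong s) rel-b ∙ dcong-[,] s a b
    ; rel-cᴰ = dcong (dcong s) rel-c ∙ dcong-[,] s b c
    ; rel-dᴰ = dcong (dcong s) rel-d ∙ dcong-[,] s c d
    }

record HigmanHIT : Setω where
  field
    BH           : Set
    constructors : HigmanData BH
    induction    : (P : BH → Set ℓ) (D : HigmanDataOver constructors P) →
                   Σ[ s ∈ (∀ x → P x) ] restrictHigman constructors s ≡ D

{-# OPTIONS --without-K #-}
-- The suspension of BH is contractible as soon as every map f from BH to a
-- type of paths x ≡ y is constant.  Loops in x ≡ y commute (Eckmann–Hilton),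
-- so every commutator is trivial there, naturally in its two arguments.  Hence
-- for the family f pt ≡ f z the commutator over [ p , q ] is the same for all
-- paths over p and q, and the 2-cells a = [ d , a ], …, d = [ c , d ] merely
-- prescribe the values on a, b, c, d.
module Submission where

open import Level using (Level)
open import Data.Product using (Σ-syntax; _,_; proj₁; proj₂)
open import Data.Unit using (tt)
open import Function using (_∘_)
open import Relation.Binary.PropositionalEquality
  using (_≡_; refl; sym; cong; cong-id; naturality; subst; subst-∘;
         subst-subst-sym; subst-sym-subst; trans-symʳ; module ≡-Reasoning)

open import Defs

private
  variable
    i j ℓ : Level
    X Y Z : Set i

module _ {x : X} where

  -- Carried along all paths out of `x`, `v` becomes a homotopy from the identity of `x ≡ y` to
  -- itself.
  refl-loop-everywhere : _≡_ {A = x ≡ x} refl refl → ∀ {y} (s : x ≡ y) → s ≡ s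
  refl-loop-everywhere v refl = v

  -- Once `w` is `refl`, this is the naturality square at `u` of the self-homotopy of the identity
  -- spread from `v`.
  Eckmann–Hilton : ∀ {y} {w : x ≡ y} (u v : w ≡ w) → u ∙ v ≡ v ∙ u
  Eckmann–Hilton {w = refl} u v =
    subst (λ u′ → u′ ∙ v ≡ v ∙ u′) (cong-id u)
      (naturality (λ s → refl-loop-everywhere v s))

commuting⇒[,]≡refl : {x : X} (p q : x ≡ x) → p ∙ q ≡ q ∙ p → [ p , q ] ≡ refl
commuting⇒[,]≡refl p q h =
  cong (λ r → r ∙ sym p ∙ sym q) h ∙ cancel q p
  where
  cancel : {x y z : X} (q : x ≡ y) (p : y ≡ z) → q ∙ p ∙ sym p ∙ sym q ≡ refl
  cancel refl refl = refl

module _ {x : X} where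

  private
    OverTo : {y : X} (t u : x ≡ y) → Set _
    OverTo t u = PathOver (x ≡_) u refl t

  subst-refl : ∀ {y} (u : x ≡ y) → OverTo u u
  subst-refl refl = refl

  -- `OverTo t u` amounts to `u ≡ t`, so these pairs form a singleton type.
  over-contr : ∀ {y} {t : x ≡ y} (r : Σ[ u ∈ x ≡ y ] OverTo t u) → (t , subst-refl t) ≡ r
  over-contr (refl , refl) = refl

  -- The pairs `(u , α)` and `(v , β)` each range over a contractible type, so the two sides need
  -- comparing only at `refl`, where `h` makes them agree.
  [,]ᴰ-trivial : (triv : (u v : x ≡ x) → [ u , v ] ≡ refl) → triv refl refl ≡ refl →
    {u v : x ≡ x} (α : OverTo refl u) (β : OverTo refl v) →
    subst (OverTo refl) (sym (triv u v)) refl ≡ [_,_]ᴰ {p = u} {q = v} α β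
  [,]ᴰ-trivial triv h {u} {v} α β =
    subst (λ r → Trivial (u , α) r) (over-contr (v , β))
      (subst (λ r → Trivial r (refl , refl)) (over-contr (u , α))
        (cong (λ e → subst (OverTo refl) (sym e) refl) h))
    where
    Trivial : (r s : Σ[ u ∈ x ≡ x ] OverTo refl u) → Set _
    Trivial (u , α) (v , β) =
      subst (OverTo refl) (sym (triv u v)) refl ≡ [_,_]ᴰ {p = u} {q = v} α β

-- [ p , q ] and [_,_]ᴰ with the endpoints kept apart, so that all four paths
-- can be eliminated.
cong-comm : (f : Z → Y) {x y z w v : Z} (p : x ≡ y) (q : y ≡ z) (p′ : w ≡ z) (q′ : v ≡ w) →
  cong f (p ∙ q ∙ sym p′ ∙ sym q′) ≡
  cong f p ∙ cong f q ∙ sym (cong f p′) ∙ sym (cong f q′)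
cong-comm f refl refl refl refl = refl

commᴰ : {Q : Z → Set j} {x y z w v : Z}
  (p : x ≡ y) (q : y ≡ z) (p′ : w ≡ z) (q′ : v ≡ w)
  {s₀ : Q x} {s₁ : Q y} {s₂ : Q z} {s₃ : Q w} {s₄ : Q v} →
  PathOver Q p s₀ s₁ → PathOver Q q s₁ s₂ → PathOver Q p′ s₃ s₂ → PathOver Q q′ s₄ s₃ →
  PathOver Q (p ∙ q ∙ sym p′ ∙ sym q′) s₀ s₄
commᴰ p q p′ q′ α β α′ β′ =
  _∙ᴰ_ {p = p ∙ q ∙ sym p′} {q = sym q′}
    (_∙ᴰ_ {p = p ∙ q} {q = sym p′} (_∙ᴰ_ {p = p} {q = q} α β) (symᴰ {p = p′} α′))
    (symᴰ {p = q′} β′)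

module _ (f : Z → Y) (P : Y → Set ℓ) where

  pushOver : {x y : Z} (p : x ≡ y) {s : P (f x)} {t : P (f y)} →
             PathOver (P ∘ f) p s t → PathOver P (cong f p) s t
  pushOver p α = sym (subst-∘ p) ∙ α

  pullOver : {x y : Z} (p : x ≡ y) {s : P (f x)} {t : P (f y)} →
             PathOver P (cong f p) s t → PathOver (P ∘ f) p s t
  pullOver p α = subst-∘ p ∙ α

  pull-push : {x y : Z} (p : x ≡ y) {s : P (f x)} {t : P (f y)}
              (α : PathOver (P ∘ f) p s t) → pullOver p (pushOver p α) ≡ α
  pull-push refl α = refl

  push-comm : {x y z w v : Z} (p : x ≡ y) (q : y ≡ z) (p′ : w ≡ z) (q′ : v ≡ w)
    {s₀ : P (f x)} {s₁ : P (f y)} {s₂ : P (f z)} {s₃ : P (f w)} {s₄ : P (f v)}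
    (α : PathOver (P ∘ f) p s₀ s₁) (β : PathOver (P ∘ f) q s₁ s₂)
    (α′ : PathOver (P ∘ f) p′ s₃ s₂) (β′ : PathOver (P ∘ f) q′ s₄ s₃) →
    subst (λ u → PathOver P u s₀ s₄) (cong-comm f p q p′ q′)
      (pushOver (p ∙ q ∙ sym p′ ∙ sym q′) (commᴰ p q p′ q′ α β α′ β′)) ≡
    commᴰ (cong f p) (cong f q) (cong f p′) (cong f q′)
      (pushOver p α) (pushOver q β) (pushOver p′ α′) (pushOver q′ β′)
  push-comm refl refl refl refl refl refl refl refl = refl

-- The value γ is asked for even when no path over p or q is given: this is what
-- lets the 2-cells define the action on a, b, c, d without circularity.
ConstantCommutators : {Z : Set i} (P : Z → Set j) {z : Z} → P z → Set _
ConstantCommutators P {z} s = (p q : z ≡ z) →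
  Σ[ γ ∈ PathOver P [ p , q ] s s ]
    ((α : PathOver P p s s) (β : PathOver P q s s) → γ ≡ [_,_]ᴰ {p = p} {q = q} α β)

-- Pushed along `f`, the paths over lie in the family of paths out of `f z`, where their commutator
-- depends on the base loops alone; the required value is this one pulled back.
constantCommutators : {x y : X} (f : Z → x ≡ y) (z : Z) →
  ConstantCommutators (λ z′ → f z ≡ f z′) {z} refl
constantCommutators f z p q =
  pullOver f P [ p , q ] (subst Over (sym e) γ) , λ α β → begin
    pullOver f P [ p , q ] (subst Over (sym e) γ)
      ≡⟨ cong (pullOver f P [ p , q ] ∘ subst Over (sym e))
           ([,]ᴰ-trivial triv (trans-symʳ (EH refl refl)) (pushOver f P p α) (pushOver f P q β)
             ∙ sym (push-comm f P p q p q α β α β)) ⟩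
    pullOver f P [ p , q ] (subst Over (sym e) (subst Over e (pushOver f P [ p , q ] _)))
      ≡⟨ cong (pullOver f P [ p , q ]) (subst-sym-subst e) ⟩
    pullOver f P [ p , q ] (pushOver f P [ p , q ] _)
      ≡⟨ pull-push f P [ p , q ] _ ⟩
    [_,_]ᴰ {p = p} {q = q} α β ∎
  where
  open ≡-Reasoning
  P = f z ≡_
  Over = λ (u : f z ≡ f z) → PathOver P u refl refl
  e = cong-comm f p q p q
  EH : (u v : f z ≡ f z) → [ u , v ] ≡ refl
  EH u v = commuting⇒[,]≡refl u v (Eckmann–Hilton u v)
  -- Normalised to be refl at (refl , refl), whatever Eckmann–Hilton gives there.
  triv : (u v : f z ≡ f z) → [ u , v ] ≡ refl
  triv u v = EH u v ∙ sym (EH refl refl)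
  γ = subst Over (sym (triv (cong f p) (cong f q))) refl

module _ {Z : Set i} (K : HigmanData Z) where
  open HigmanData K

  -- Each generator is the left side of exactly one 2-cell, so its value can be the constant
  -- commutator transported back along that cell; the cell then lifts whatever the other values are.
  higmanDataOver : {P : Z → Set j} (s : P pt) → ConstantCommutators P s → HigmanDataOver K P
  higmanDataOver {P = P} s C = record
    { ptᴰ    = s
    ; aᴰ     = value d a rel-a
    ; bᴰ     = value a b rel-b
    ; cᴰ     = value b c rel-c
    ; dᴰ     = value c d rel-d
    ; rel-aᴰ = over d a rel-a
    ; rel-bᴰ = over a b rel-b
    ; rel-cᴰ = over b c rel-c
    ; rel-dᴰ = over c d rel-d
    }
    where
    LoopOver = λ (p : pt ≡ pt) → PathOver P p s s
    value : ∀ p q {r} → r ≡ [ p , q ] → LoopOver r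
    value p q e = subst LoopOver (sym e) (proj₁ (C p q))
    over : ∀ p q {r} (e : r ≡ [ p , q ]) {α : LoopOver p} {β : LoopOver q} →
           PathOver LoopOver e (value p q e) ([_,_]ᴰ {p = p} {q = q} α β)
    over p q e {α} {β} = subst-subst-sym e ∙ proj₂ (C p q) α β

module _ (H : HigmanHIT) where
  open HigmanHIT H
  open HigmanData constructors using (pt)

  map-to-paths-constant : {x y : X} (f : BH → x ≡ y) (z : BH) → f pt ≡ f z
  map-to-paths-constant f =
    proj₁ (induction _ (higmanDataOver constructors refl (constantCommutators f pt)))

proposition7p5 : (T : HoTT) (H : HigmanHIT) → HoTT.Acyclic T (HigmanHIT.BH H)
proposition7p5 T H = S.inl tt , proj₁ (S.induction (S.inl tt ≡_) (mkPushoutDataOver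
  (λ _ → refl)
  (λ _ → S.glue (HigmanData.pt constructors))
  -- Transporting `refl` along the meridian of `z` gives that meridian, while the south pole was
  -- assigned the meridian of `pt`; constancy of `S.glue` identifies them.
  (λ z → subst-refl (S.glue z) ∙ sym (map-to-paths-constant H S.glue z))))
  where
  open HigmanHIT H using (BH; constructors)
  suspension : Pushout {C = BH} (λ _ → tt) (λ _ → tt)
  suspension = HoTT.pushout T (λ _ → tt) (λ _ → tt)
  module S = Pushout suspension
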